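{- Let $(L,\vee,\wedge,0,1)$ be a non-trivial complete lattice, let $(T,R)$ be a time frame, let $P,F,H,G\colon L^T\to L^T$ denote the tense operators induced by $(T,R)$, and let $R^*$ denote the relation induced by $P$, $F$, $H$ and $G$. Then $R=R^*$, and hence the tense operators induced by the time frame $(T,R^*)$ coincide with those induced by the time frame $(T,R)$.
   Context: A time frame is a pair $(T,R)$ consisting of a non-empty set $T$ and a non-empty binary relation $R\subseteq T\times T$; $s\mathrel R t$ means $(s,t)\in R$. Here $0$ and $1$ are the least and greatest elements of $L$; non-trivial means that $L$ has more than one element. $L^T$ is the set of all functions $T\to L$, ordered pointwise. The tense operators $P,F,H,G\colon L^T\to L^T$ induced by $(T,R)$ are defined, for $q\in L^T$ and $s\in T$, by $P(q)(s):=\bigvee\{q(t)\mid t\mathrel R s\}$, $F(q)(s):=\bigvee\{q(t)\mid s\mathrel R t\}$, $H(q)(s):=\bigwedge\{q(t)\mid t\mathrel R s\}$, $G(q)(s):=\bigwedge\{q(t)\mid s\mathrel R t\}$, where the join of the empty set is $0$ and the meet of the empty set is $1$. Given maps $P,F,H,G\colon L^T\to L^T$, the relation induced by $P$, $F$, $H$ and $G$ is the set of all $(s,t)\in T^2$ such that for all $q\in L^T$: $q(s)\leq P(q)(t)$, $q(t)\leq F(q)(s)$, $H(q)(t)\leq q(s)$ and $G(q)(s)\leq q(t)$. -}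

module Defs where

open import Level using (Level; suc)
open import Data.Product using (∃-syntax; ∃₂; _×_)
open import Relation.Nullary using (¬_)
open import Relation.Unary using (Pred)
open import Relation.Binary.Core using (Rel)
open import Relation.Binary.Definitions using (NonEmpty)
open import Relation.Binary.Lattice.Bundles using (BoundedLattice)

private
  variable
    ℓ : Level

module _ {A : Set ℓ} (_≤_ : Rel A ℓ) where

  IsJoin : Pred A ℓ → A → Set ℓ
  IsJoin S x = (∀ y → S y → y ≤ x) × (∀ z → (∀ y → S y → y ≤ z) → x ≤ z)

  IsMeet : Pred A ℓ → A → Set ℓ
  IsMeet S x = (∀ y → S y → x ≤ y) × (∀ z → (∀ y → S y → z ≤ y) → z ≤ x)

-- The carrier, its subsets and the truth values of _≈_ and _≤_ all live in
-- one universe, playing the role of the universe of sets: a relation defined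
-- by quantifying over all functions T → Carrier is then again a relation in
-- that universe.
record CompleteLattice (ℓ : Level) : Set (suc ℓ) where
  field
    boundedLattice : BoundedLattice ℓ ℓ ℓ

  open BoundedLattice boundedLattice public

  field
    ⋁        : Pred Carrier ℓ → Carrier
    ⋁-isJoin : ∀ S → IsJoin _≤_ S (⋁ S)
    ⋀        : Pred Carrier ℓ → Carrier
    ⋀-isMeet : ∀ S → IsMeet _≤_ S (⋀ S)

NonTrivial : CompleteLattice ℓ → Set ℓ
NonTrivial L = ∃₂ λ x y → ¬ (x ≈ y)
  where open CompleteLattice L

record IsTimeFrame (T : Set ℓ) (R : Rel T ℓ) : Set ℓ where
  field
    T-nonEmpty : T
    R-nonEmpty : NonEmpty R

module Tense (L : CompleteLattice ℓ) (T : Set ℓ) where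

  open CompleteLattice L

  -- The operators make sense for any relation; over an empty index set the
  -- join is ⊥ and the meet is ⊤ up to _≈_, by the universal properties.
  module Operators (R : Rel T ℓ) where

    P F H G : (T → Carrier) → (T → Carrier)
    P q s = ⋁ (λ x → ∃[ t ] R t s × x ≈ q t)
    F q s = ⋁ (λ x → ∃[ t ] R s t × x ≈ q t)
    H q s = ⋀ (λ x → ∃[ t ] R t s × x ≈ q t)
    G q s = ⋀ (λ x → ∃[ t ] R s t × x ≈ q t)

  InducedRelation : (P F H G : (T → Carrier) → (T → Carrier)) → Rel T ℓ
  InducedRelation P F H G s t = ∀ (q : T → Carrier) →
    q s ≤ P q t × q t ≤ F q s × H q t ≤ q s × G q s ≤ q t

  infix 4 _≋_

  _≋_ : Rel ((T → Carrier) → (T → Carrier)) ℓ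
  A ≋ B = ∀ q s → A q s ≈ B q s

{-# OPTIONS --safe #-}
-- For R* ⊆ R, fix t and test P on the characteristic function q of the
-- complement of the set of R-predecessors of t: then P q t is ⊥, so
-- q s ≤ P q t forces q s ≠ ⊤, i.e. R s t.
module Submission where

open import Defs
open import Level using (Level)
open import Data.Empty using (⊥-elim)
open import Data.Product using (_×_; _,_; proj₁; proj₂)
open import Data.Bool using (if_then_else_)
open import Relation.Nullary using (¬_; Dec; yes; no; does)
open import Relation.Unary using (Pred; _⊆_)
open import Relation.Binary.Core using (Rel; _⇒_; _⇔_)
open import Relation.Binary.Definitions using (nonEmpty)
open import Axiom.ExcludedMiddle using (ExcludedMiddle)

-- If `R s t`, then `q s` and `q t` are members of the families whose joins and meets define the
-- operators, so all four inequalities hold and `R` is contained in `R*`. The converse needs a test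
-- function that separates non-predecessors of `t` from predecessors; its values `⊥` and `⊤` differ
-- because `L` is non-trivial, and excluded middle makes it definable. Relations with the same pairs
-- have the same families, hence the same operators.

module _ {ℓ : Level} (L : CompleteLattice ℓ) where

  open CompleteLattice L

  ⋁-upper : ∀ {S : Pred Carrier ℓ} {x} → S x → x ≤ ⋁ S
  ⋁-upper {S} {x} = proj₁ (⋁-isJoin S) x

  ⋁-least : ∀ {S : Pred Carrier ℓ} {z} → (∀ y → S y → y ≤ z) → ⋁ S ≤ z
  ⋁-least {S} {z} = proj₂ (⋁-isJoin S) z

  ⋀-lower : ∀ {S : Pred Carrier ℓ} {x} → S x → ⋀ S ≤ x
  ⋀-lower {S} {x} = proj₁ (⋀-isMeet S) x

  ⋀-greatest : ∀ {S : Pred Carrier ℓ} {z} → (∀ y → S y → z ≤ y) → z ≤ ⋀ S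
  ⋀-greatest {S} {z} = proj₂ (⋀-isMeet S) z

  -- Mutually included predicates need not be equal as terms, so the universal property has to
  -- supply `_≈_`.
  ⋁-cong : ∀ {S S′ : Pred Carrier ℓ} → S ⊆ S′ → S′ ⊆ S → ⋁ S ≈ ⋁ S′
  ⋁-cong S⊆S′ S′⊆S = antisym (⋁-least λ _ y∈S → ⋁-upper (S⊆S′ y∈S))
                             (⋁-least λ _ y∈S′ → ⋁-upper (S′⊆S y∈S′))

  ⋀-cong : ∀ {S S′ : Pred Carrier ℓ} → S ⊆ S′ → S′ ⊆ S → ⋀ S ≈ ⋀ S′
  ⋀-cong S⊆S′ S′⊆S = antisym (⋀-greatest λ _ y∈S′ → ⋀-lower (S′⊆S y∈S′))
                             (⋀-greatest λ _ y∈S → ⋀-lower (S⊆S′ y∈S))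

  -- Otherwise `a ≤ ⊤ ≤ ⊥ ≤ b` for all `a` and `b`, and antisymmetry identifies all elements.
  ⊤≰⊥ : NonTrivial L → ¬ (⊤ ≤ ⊥)
  ⊤≰⊥ (x , y , x≉y) ⊤≤⊥ = x≉y (antisym (below x y) (below y x))
    where
    below : ∀ a b → a ≤ b
    below a b = trans (maximum a) (trans ⊤≤⊥ (minimum b))

  module _ {T : Set ℓ} where

    open Tense L T

    module _ {Q R : Rel T ℓ} (Q⇔R : Q ⇔ R) where

      private
        module OQ = Operators Q
        module OR = Operators R
        Q⇒R = proj₁ Q⇔R
        R⇒Q = proj₂ Q⇔R

      operators-cong : (OQ.P ≋ OR.P) × (OQ.F ≋ OR.F) × (OQ.H ≋ OR.H) × (OQ.G ≋ OR.G)
      operators-cong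
        = (λ q s → ⋁-cong (λ (t , r , e) → t , Q⇒R r , e) (λ (t , r , e) → t , R⇒Q r , e))
        , (λ q s → ⋁-cong (λ (t , r , e) → t , Q⇒R r , e) (λ (t , r , e) → t , R⇒Q r , e))
        , (λ q s → ⋀-cong (λ (t , r , e) → t , Q⇒R r , e) (λ (t , r , e) → t , R⇒Q r , e))
        , (λ q s → ⋀-cong (λ (t , r , e) → t , Q⇒R r , e) (λ (t , r , e) → t , R⇒Q r , e))

    module _ (R : Rel T ℓ) where

      open Operators R

      R⇒induced : R ⇒ InducedRelation P F H G
      R⇒induced {s} {t} Rst q
        = ⋁-upper (s , Rst , Eq.refl)
        , ⋁-upper (t , Rst , Eq.refl)
        , ⋀-lower (s , Rst , Eq.refl)
        , ⋀-lower (t , Rst , Eq.refl)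

      induced⇒R : ExcludedMiddle ℓ → NonTrivial L → InducedRelation P F H G ⇒ R
      induced⇒R em nt {s} {t} R*st = χᶜ≤⊥⇒holds em (trans (proj₁ (R*st q)) Pqt≤⊥)
        where
        -- Taking the decision as an argument lets the two lemmas below split on it; `q s` unfolds
        -- to `χᶜ` at the decision `em` makes for `R s t`.
        χᶜ : ∀ {A : Set ℓ} → Dec A → Carrier
        χᶜ d = if does d then ⊥ else ⊤

        q : T → Carrier
        q x = χᶜ (em {R x t})

        χᶜ≤⊥ : ∀ {A : Set ℓ} (d : Dec A) → A → χᶜ d ≤ ⊥
        χᶜ≤⊥ (yes _) _ = refl
        χᶜ≤⊥ (no ¬a) a = ⊥-elim (¬a a)

        Pqt≤⊥ : P q t ≤ ⊥
        Pqt≤⊥ = ⋁-least λ _ (x , Rxt , y≈qx) → trans (reflexive y≈qx) (χᶜ≤⊥ em Rxt)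

        χᶜ≤⊥⇒holds : ∀ {A : Set ℓ} (d : Dec A) → χᶜ d ≤ ⊥ → A
        χᶜ≤⊥⇒holds (yes a) _   = a
        χᶜ≤⊥⇒holds (no _)  ⊤≤⊥ = ⊥-elim (⊤≰⊥ nt ⊤≤⊥)

theorem5p6 :
    ∀ {ℓ : Level} → ExcludedMiddle ℓ →
    (L : CompleteLattice ℓ) → NonTrivial L →
    (T : Set ℓ) (R : Rel T ℓ) → IsTimeFrame T R →
    let open Tense L T
        module O = Operators R
        R* = InducedRelation O.P O.F O.H O.G
        module O* = Operators R*
    in  (R ⇔ R*)
      × IsTimeFrame T R*
      × (O*.P ≋ O.P) × (O*.F ≋ O.F) × (O*.H ≋ O.H) × (O*.G ≋ O.G)
theorem5p6 em L nt T R tf =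
  (R⇒R* , R*⇒R) , timeFrame* , operators-cong L (R*⇒R , R⇒R*)
  where
  open Tense L T
  open Operators R
  R* = InducedRelation P F H G

  R⇒R* : R ⇒ R*
  R⇒R* = R⇒induced L R

  R*⇒R : R* ⇒ R
  R*⇒R = induced⇒R L R em nt

  timeFrame* : IsTimeFrame T R*
  -- A pair related by `R` is also related by `R*`.
  timeFrame* with nonEmpty Rst ← IsTimeFrame.R-nonEmpty tf = record
    { T-nonEmpty = IsTimeFrame.T-nonEmpty tf
    ; R-nonEmpty = nonEmpty (R⇒R* Rst)
    }
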